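{- For every integer $n \geq 4$, $$\gamma_{b,2}(C_4 \square C_n) = 4\left\lfloor \frac{n}{6} \right\rfloor + \begin{cases} 0 & \text{if } n \equiv 0 \pmod 6,\\ 2 & \text{if } n \equiv 1 \text{ or } 2 \pmod 6,\\ 3 & \text{if } n \equiv 3 \text{ or } 4 \pmod 6,\\ 4 & \text{if } n \equiv 5 \pmod 6.\end{cases}$$
   Context: For a graph $G$, a $2$-limited broadcast is a function $f: V(G) \to \{0,1,2\}$. A vertex $u$ hears the broadcast from $v$ if $f(v) > 0$ and $d(u,v) \leq f(v)$, where $d$ is the distance in $G$. The broadcast $f$ is dominating if every vertex of $G$ hears the broadcast from some vertex. The cost of $f$ is $\sum_{v \in V(G)} f(v)$. The $2$-limited broadcast domination number $\gamma_{b,2}(G)$ is the minimum cost of a $2$-limited dominating broadcast on $G$. $C_n$ denotes the cycle on $n$ vertices and $\square$ the Cartesian product of graphs. -}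

module Defs where

open import Data.Fin using (Fin; toℕ)
open import Data.Fin.Patterns using (0F; 1F; 2F; 3F; 4F; 5F)
open import Data.List using (List; map; allFin; cartesianProduct)
open import Data.List.Membership.Propositional using (_∈_)
open import Data.List.Membership.Propositional.Properties
  using (∈-allFin; ∈-cartesianProduct⁺)
open import Data.List.Relation.Unary.Unique.Propositional using (Unique)
open import Data.List.Relation.Unary.Unique.Propositional.Properties
  using (allFin⁺; cartesianProduct⁺)
open import Data.Nat using (ℕ; zero; suc; _≤_; _>_)
open import Data.Nat.ListAction using (sum)
open import Data.Product using (_×_; _,_; ∃-syntax)
open import Data.Sum using (_⊎_; inj₁; inj₂)
import Data.Sum as Sum
open import Function using (_∘_)
open import Relation.Binary.PropositionalEquality using (_≡_; _≢_; refl; sym)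
open import Relation.Nullary using (¬_)

-- Finite simple graphs.  The vertices are listed exactly once each, so that
-- sums over the vertex set can be taken along the list.
record Graph : Set₁ where
  field
    V          : Set
    _~_        : V → V → Set
    ~-sym      : ∀ {u v} → u ~ v → v ~ u
    ~-irrefl   : ∀ {v} → ¬ (v ~ v)
    vertices   : List V
    complete   : ∀ v → v ∈ vertices
    unique     : Unique vertices

module _ (G : Graph) where
  open Graph G

  -- Walk u v ℓ : walks from u to v with ℓ edges.
  data Walk : V → V → ℕ → Set where
    []  : ∀ {v} → Walk v v zero
    _∷_ : ∀ {u v w ℓ} → u ~ v → Walk v w ℓ → Walk u w (suc ℓ)

  -- d(u , v) = d.  No d satisfies this when u and v lie in different
  -- components, i.e. when their distance is infinite.
  IsDistance : V → V → ℕ → Set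
  IsDistance u v d = Walk u v d × (∀ ℓ → Walk u v ℓ → d ≤ ℓ)

  Broadcast : ℕ → Set
  Broadcast k = V → Fin (suc k)

  module _ {k : ℕ} (f : Broadcast k) where

    HearsFrom : V → V → Set
    HearsFrom u v = toℕ (f v) > 0 × ∃[ d ] (IsDistance u v d × d ≤ toℕ (f v))

    Dominating : Set
    Dominating = ∀ u → ∃[ v ] HearsFrom u v

    cost : ℕ
    cost = sum (map (toℕ ∘ f) vertices)

-- γ-b[ k , G ]≡ m : the minimum cost of a k-limited dominating broadcast on G
-- is m.  It is stated as a relation, which determines m uniquely.
γ-b[_,_]≡_ : ℕ → Graph → ℕ → Set
γ-b[ k , G ]≡ m =
  (∃[ f ] (Dominating G {k} f × cost G f ≡ m)) ×
  (∀ (f : Broadcast G k) → Dominating G f → m ≤ cost G f)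

infixr 7 _□_

_□_ : Graph → Graph → Graph
G □ H = record
  { V        = G.V × H.V
  ; _~_      = λ (g , h) (g′ , h′) → (g ≡ g′ × h H.~ h′) ⊎ (g G.~ g′ × h ≡ h′)
  ; ~-sym    = λ where
      (inj₁ (p , e)) → inj₁ (sym p , H.~-sym e)
      (inj₂ (e , p)) → inj₂ (G.~-sym e , sym p)
  ; ~-irrefl = λ where
      (inj₁ (_ , e)) → H.~-irrefl e
      (inj₂ (e , _)) → G.~-irrefl e
  ; vertices = cartesianProduct G.vertices H.vertices
  ; complete = λ (g , h) → ∈-cartesianProduct⁺ (G.complete g) (H.complete h)
  ; unique   = cartesianProduct⁺ G.unique H.unique
  }
  where
    module G = Graph G
    module H = Graph H

Successor : ∀ {n} → Fin n → Fin n → Set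
Successor {n} i j = suc (toℕ i) ≡ toℕ j ⊎ (suc (toℕ i) ≡ n × toℕ j ≡ 0)

-- The cycle on n vertices for n ≥ 3.  There i ≢ j is implied by the second
-- component; it only excludes a loop in the degenerate case n = 1.
C : ℕ → Graph
C n = record
  { V        = Fin n
  ; _~_      = λ i j → i ≢ j × (Successor i j ⊎ Successor j i)
  ; ~-sym    = λ (i≢j , e) → i≢j ∘ sym , Sum.swap e
  ; ~-irrefl = λ (i≢i , _) → i≢i refl
  ; vertices = allFin n
  ; complete = ∈-allFin
  ; unique   = allFin⁺ n
  }

correction : Fin 6 → ℕ
correction 0F = 0
correction 1F = 2
correction 2F = 2
correction 3F = 3
correction 4F = 3
correction 5F = 4

module Submission where

open import Defs
open import Data.Bool using (if_then_else_)
open import Data.Empty using (⊥)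
open import Data.Fin using (Fin; zero; suc; toℕ; fromℕ<)
import Data.Fin as F
open import Data.Fin.Patterns using (0F; 1F; 2F; 3F; 4F; 5F)
import Data.Fin.Properties as F
open import Data.List
  using (List; []; _∷_; _++_; map; allFin; tabulate; applyUpTo; cartesianProduct; length)
import Data.List.Membership.DecPropositional as DecMembership
open import Data.List.Membership.Propositional using (_∈_)
open import Data.List.Properties using (map-++; map-∘; map-cong; map-tabulate)
open import Data.List.Relation.Unary.All using (All; lookup) renaming (all? to allᴸ?)
open import Data.List.Relation.Unary.Any using (here; there)
open import Data.Nat
open import Data.Nat.DivMod
open import Data.Nat.ListAction using (sum)
open import Data.Nat.ListAction.Properties using (sum-++)
open import Data.Nat.Properties
open import Data.Nat.Tactic.RingSolver using (solve-∀)
open import Data.Product using (_×_; _,_; ∃-syntax; proj₁; proj₂)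
open import Data.Product.Properties using (≡-dec)
open import Data.Sum using (_⊎_; inj₁; inj₂)
open import Function using (_∘_)
open import Relation.Binary.PropositionalEquality
open import Relation.Nullary
open import Relation.Nullary.Decidable using (from-yes; _→-dec_; _×-dec_; _⊎-dec_; ¬?)

-- Lower bound.  Only the numbers bᵣ of 2s and aᵣ of 1s in each of the four rows
-- matter.  A 2 is heard by 5 vertices of its own row, 3 of each adjacent row and
-- 1 of the opposite row; a 1 is heard by 3 and by 1 of each adjacent row.  Hence
-- n ≤ 5b₀ + 3b₁ + b₂ + 3b₃ + 3a₀ + a₁ + a₃, and cyclically.  The sum of the four
-- inequalities reads 4n + Σ aᵣ ≤ 6 · cost, which suffices unless n ≡ 1 or 3
-- (mod 6).  In these two cases a cheaper broadcast leaves so little slack that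
-- comparing opposite rows determines b₀ − b₂ and b₁ − b₃; then Σ bᵣ has the
-- wrong parity.
--
-- Upper bound.  Balls of radius 2 around (0 , 6i) and (2 , 6i + 3) tile the
-- graph when 6 ∣ n; the other residues require a different last block.

-- Arithmetic of the row totals

total : ℕ → ℕ → ℕ → ℕ → ℕ
total w x y z = w + (x + (y + z))

rotate-total : ∀ w x y z → total x y z w ≡ total w x y z
rotate-total w x y z = lemma w x y z
  where
  lemma : ∀ w x y z → x + (y + (z + w)) ≡ w + (x + (y + z))
  lemma = solve-∀

-- With bᵢ twos and aᵢ ones in row i, the number of pairs of a vertex in row 0
-- and a vertex it hears.
heard : (b₀ b₁ b₂ b₃ a₀ a₁ a₃ : ℕ) → ℕ
heard b₀ b₁ b₂ b₃ a₀ a₁ a₃ = (5 * b₀ + (3 * b₁ + (b₂ + 3 * b₃))) + (3 * a₀ + (a₁ + a₃))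

-- Adjacent rows enter `heard` with coefficient 3, so subtracting `3 * total b₀ b₁ b₂ b₃` cancels
-- them and leaves a comparison of row 0 with row 2 alone.
opposite-rows : ∀ {n} d b₀ b₁ b₂ b₃ a₀ a₁ a₃ → n ≡ 3 * total b₀ b₁ b₂ b₃ + d →
  n ≤ heard b₀ b₁ b₂ b₃ a₀ a₁ a₃ → d + 2 * b₂ ≤ 2 * b₀ + (3 * a₀ + (a₁ + a₃))
opposite-rows d b₀ b₁ b₂ b₃ a₀ a₁ a₃ refl h =
  +-cancelˡ-≤ (3 * total b₀ b₁ b₂ b₃) _ _ (begin
    3 * total b₀ b₁ b₂ b₃ + (d + 2 * b₂)  ≡⟨ +-assoc (3 * total b₀ b₁ b₂ b₃) d _ ⟨
    3 * total b₀ b₁ b₂ b₃ + d + 2 * b₂    ≤⟨ +-monoˡ-≤ (2 * b₂) h ⟩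
    heard b₀ b₁ b₂ b₃ a₀ a₁ a₃ + 2 * b₂   ≡⟨ lemma b₀ b₁ b₂ b₃ (3 * a₀ + (a₁ + a₃)) ⟩
    3 * total b₀ b₁ b₂ b₃ + (2 * b₀ + (3 * a₀ + (a₁ + a₃)))  ∎)
  where
  open ≤-Reasoning
  lemma : ∀ b₀ b₁ b₂ b₃ x → ((5 * b₀ + (3 * b₁ + (b₂ + 3 * b₃))) + x) + 2 * b₂
        ≡ 3 * (b₀ + (b₁ + (b₂ + b₃))) + (2 * b₀ + x)
  lemma = solve-∀

module _ (n b₀ b₁ b₂ b₃ a₀ a₁ a₂ a₃ : ℕ) where
  record AllHear : Set where
    constructor hears
    field
      row₀ : n ≤ heard b₀ b₁ b₂ b₃ a₀ a₁ a₃
      row₁ : n ≤ heard b₁ b₂ b₃ b₀ a₁ a₂ a₀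
      row₂ : n ≤ heard b₂ b₃ b₀ b₁ a₂ a₃ a₁
      row₃ : n ≤ heard b₃ b₀ b₁ b₂ a₃ a₀ a₂

rotate-hears : ∀ {n b₀ b₁ b₂ b₃ a₀ a₁ a₂ a₃} →
  AllHear n b₀ b₁ b₂ b₃ a₀ a₁ a₂ a₃ → AllHear n b₁ b₂ b₃ b₀ a₁ a₂ a₃ a₀
rotate-hears (hears h₀ h₁ h₂ h₃) = hears h₁ h₂ h₃ h₀

-- Over all four rows a 2 is counted 5 + 3 + 1 + 3 = 12 times, exactly six per unit of cost. A 1 is
-- counted 3 + 1 + 1 = 5 times, one short of six; this deficit is the extra summand on the left.
double-count : ∀ {n} b₀ b₁ b₂ b₃ a₀ a₁ a₂ a₃ → AllHear n b₀ b₁ b₂ b₃ a₀ a₁ a₂ a₃ →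
  4 * n + total a₀ a₁ a₂ a₃ ≤ 6 * (total a₀ a₁ a₂ a₃ + 2 * total b₀ b₁ b₂ b₃)
double-count {n} b₀ b₁ b₂ b₃ a₀ a₁ a₂ a₃ (hears h₀ h₁ h₂ h₃) = begin
  4 * n + total a₀ a₁ a₂ a₃
    ≤⟨ +-monoˡ-≤ _ (+-mono-≤ h₀ (+-mono-≤ h₁ (+-mono-≤ h₂ (+-mono-≤ h₃ z≤n)))) ⟩
  heard b₀ b₁ b₂ b₃ a₀ a₁ a₃ + (heard b₁ b₂ b₃ b₀ a₁ a₂ a₀
    + (heard b₂ b₃ b₀ b₁ a₂ a₃ a₁ + (heard b₃ b₀ b₁ b₂ a₃ a₀ a₂ + 0))) + total a₀ a₁ a₂ a₃
    ≡⟨ lemma b₀ b₁ b₂ b₃ a₀ a₁ a₂ a₃ ⟩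
  6 * (total a₀ a₁ a₂ a₃ + 2 * total b₀ b₁ b₂ b₃) ∎
  where
  open ≤-Reasoning
  lemma : ∀ b₀ b₁ b₂ b₃ a₀ a₁ a₂ a₃ →
    (((5 * b₀ + (3 * b₁ + (b₂ + 3 * b₃))) + (3 * a₀ + (a₁ + a₃)))
    + (((5 * b₁ + (3 * b₂ + (b₃ + 3 * b₀))) + (3 * a₁ + (a₂ + a₀)))
    + (((5 * b₂ + (3 * b₃ + (b₀ + 3 * b₁))) + (3 * a₂ + (a₃ + a₁)))
    + (((5 * b₃ + (3 * b₀ + (b₁ + 3 * b₂))) + (3 * a₃ + (a₀ + a₂))) + 0))))
    + (a₀ + (a₁ + (a₂ + a₃)))
    ≡ 6 * ((a₀ + (a₁ + (a₂ + a₃))) + 2 * (b₀ + (b₁ + (b₂ + b₃))))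
  lemma = solve-∀

-- Applies when the 1s contribute exactly the surplus `d` to both of two opposite rows: the two
-- comparisons then bound each row by the other.
rows-equal : ∀ {d x y} → d + 2 * x ≤ 2 * y + d → d + 2 * y ≤ 2 * x + d → x ≡ y
rows-equal {d} {x} {y} p q = ≤-antisym (halve x y p) (halve y x q)
  where
  halve : ∀ x y → d + 2 * x ≤ 2 * y + d → x ≤ y
  halve x y p = *-cancelˡ-≤ 2 (+-cancelˡ-≤ d _ _ (subst (d + 2 * x ≤_) (+-comm (2 * y) d) p))

rotate-size : ∀ {n d} w x y z → n ≡ 3 * total w x y z + d → n ≡ 3 * total x y z w + d
rotate-size {d = d} w x y z eq = trans eq (cong (λ t → 3 * t + d) (sym (rotate-total w x y z)))

no-ones⇒even : ∀ {n} b₀ b₁ b₂ b₃ → n ≡ 3 * total b₀ b₁ b₂ b₃ + 0 →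
  AllHear n b₀ b₁ b₂ b₃ 0 0 0 0 → total b₀ b₁ b₂ b₃ ≡ 2 * (b₀ + b₁)
no-ones⇒even b₀ b₁ b₂ b₃ eq (hears h₀ h₁ h₂ h₃)
  with rotate-size b₀ b₁ b₂ b₃ eq
... | eq₁ with rotate-size b₁ b₂ b₃ b₀ eq₁
... | eq₂ with rotate-size b₂ b₃ b₀ b₁ eq₂
... | eq₃ with rows-equal {0} {b₂} {b₀} (opposite-rows 0 b₀ b₁ b₂ b₃ 0 0 0 eq h₀)
                              (opposite-rows 0 b₂ b₃ b₀ b₁ 0 0 0 eq₂ h₂)
             | rows-equal {0} {b₃} {b₁} (opposite-rows 0 b₁ b₂ b₃ b₀ 0 0 0 eq₁ h₁)
                              (opposite-rows 0 b₃ b₀ b₁ b₂ 0 0 0 eq₃ h₃)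
... | refl | refl = lemma b₂ b₃
  where
  lemma : ∀ x y → x + (y + (x + y)) ≡ 2 * (x + y)
  lemma = solve-∀

-- Row 0 hears the 1 three times and row 2 never, which forces `b₂ = b₀ + 1`. Rows 1 and 3 hear it
-- once each, which balances the surplus and gives `b₁ = b₃`.
one-one⇒odd : ∀ {n} b₀ b₁ b₂ b₃ → n ≡ 3 * total b₀ b₁ b₂ b₃ + 1 →
  AllHear n b₀ b₁ b₂ b₃ 1 0 0 0 → total b₀ b₁ b₂ b₃ ≡ suc (2 * (b₀ + b₁))
one-one⇒odd b₀ b₁ b₂ b₃ eq (hears h₀ h₁ h₂ h₃)
  with rotate-size b₀ b₁ b₂ b₃ eq
... | eq₁ with rotate-size b₁ b₂ b₃ b₀ eq₁
... | eq₂ with rotate-size b₂ b₃ b₀ b₁ eq₂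
... | eq₃ with ≤-antisym
                 (halve b₂ b₀ (opposite-rows 1 b₀ b₁ b₂ b₃ 1 0 0 eq h₀))
                 (*-cancelˡ-< 2 b₀ b₂ (subst (2 * b₀ <_) (+-identityʳ (2 * b₂))
                   (opposite-rows 1 b₂ b₃ b₀ b₁ 0 0 0 eq₂ h₂)))
             | rows-equal {1} {b₃} {b₁} (opposite-rows 1 b₁ b₂ b₃ b₀ 0 0 1 eq₁ h₁)
                              (opposite-rows 1 b₃ b₀ b₁ b₂ 0 1 0 eq₃ h₃)
  where
  halve : ∀ x y → 1 + 2 * x ≤ 2 * y + 3 → x ≤ suc y
  halve x y p = *-cancelˡ-≤ 2 (+-cancelˡ-≤ 1 _ _ (subst (1 + 2 * x ≤_) (lemma y) p))
    where
    lemma : ∀ y → 2 * y + 3 ≡ 1 + 2 * (1 + y)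
    lemma = solve-∀
... | refl | refl = lemma b₀ b₃
  where
  lemma : ∀ x y → x + (y + ((1 + x) + y)) ≡ 1 + 2 * (x + y)
  lemma = solve-∀

-- By the cyclic symmetry of the rows, the single 1 can be moved to row 0 without changing the
-- number of 2s.
total-one⇒odd : ∀ {n} b₀ b₁ b₂ b₃ a₀ a₁ a₂ a₃ → total a₀ a₁ a₂ a₃ ≡ 1 →
  n ≡ 3 * total b₀ b₁ b₂ b₃ + 1 → AllHear n b₀ b₁ b₂ b₃ a₀ a₁ a₂ a₃ →
  ∃[ m ] total b₀ b₁ b₂ b₃ ≡ suc (2 * m)
total-one⇒odd b₀ b₁ b₂ b₃ a₀ a₁ a₂ a₃ eq = go₀ a₀ a₁ a₂ a₃ eq
  where
  P : (w x y z a b c d : ℕ) → Set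
  P w x y z a b c d = ∀ {n} → n ≡ 3 * total w x y z + 1 →
    AllHear n w x y z a b c d → ∃[ m ] total w x y z ≡ suc (2 * m)

  rotate : ∀ {w x y z a b c d} → P x y z w b c d a → P w x y z a b c d
  rotate {w} {x} {y} {z} p eq h with p (rotate-size w x y z eq) (rotate-hears h)
  ... | m , odd = m , trans (sym (rotate-total w x y z)) odd

  one : ∀ {w x y z} → P w x y z 1 0 0 0
  one {w} {x} {y} {z} eq h = w + x , one-one⇒odd w x y z eq h

  go₀ : ∀ a b c d → total a b c d ≡ 1 → P b₀ b₁ b₂ b₃ a b c d
  go₀ 1 0 0 0 refl = one
  go₀ 0 1 0 0 refl = rotate one
  go₀ 0 0 1 0 refl = rotate (rotate one)
  go₀ 0 0 0 1 refl = rotate (rotate (rotate one))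

-- A cost of at most `x` is too small because 6x falls short of 4n. The gap is given as an equation
-- with `suc e`, so that each instance is a ring identity.
exceeds : ∀ x e {n c a} → 6 * x + suc e ≡ 4 * n → 4 * n + a ≤ 6 * c → x < c
exceeds x e {n} {c} {a} eq d = *-cancelˡ-< 6 x c (begin-strict
  6 * x          <⟨ m<m+n (6 * x) z<s ⟩
  6 * x + suc e  ≡⟨ eq ⟩
  4 * n          ≤⟨ m≤m+n (4 * n) a ⟩
  4 * n + a      ≤⟨ d ⟩
  6 * c          ∎)
  where open ≤-Reasoning

-- Each 1 uses up one unit of the slack 6c - 4n in the double count.
few-ones : ∀ e n {c a} → 4 * n + e ≡ 6 * c → 4 * n + a ≤ 6 * c → a ≤ e
few-ones e n eq d = +-cancelˡ-≤ (4 * n) _ _ (≤-trans d (≤-reflexive (sym eq)))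

-- n = 6k + 1 and cost 4k + 1 would leave one 1 and 2k twos.
no-tight-1 : ∀ k b₀ b₁ b₂ b₃ a₀ a₁ a₂ a₃ → AllHear (1 + k * 6) b₀ b₁ b₂ b₃ a₀ a₁ a₂ a₃ →
  4 * k + 1 ≢ total a₀ a₁ a₂ a₃ + 2 * total b₀ b₁ b₂ b₃
no-tight-1 k b₀ b₁ b₂ b₃ a₀ a₁ a₂ a₃ h eq =
  by-ones a refl (few-ones 2 (1 + k * 6) {4 * k + 1} (lemma₀ k)
    (subst (λ c → 4 * (1 + k * 6) + a ≤ 6 * c) (sym eq) (double-count b₀ b₁ b₂ b₃ a₀ a₁ a₂ a₃ h)))
  where
  a b : ℕ
  a = total a₀ a₁ a₂ a₃
  b = total b₀ b₁ b₂ b₃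

  lemma₀ : ∀ k → 4 * (1 + k * 6) + 2 ≡ 6 * (4 * k + 1)
  lemma₀ = solve-∀
  lemma₁ : ∀ k → 4 * k + 1 ≡ 1 + 2 * (2 * k)
  lemma₁ = solve-∀
  lemma₂ : ∀ k → 1 + k * 6 ≡ 3 * (2 * k) + 1
  lemma₂ = solve-∀
  lemma₃ : ∀ b → 2 + 2 * b ≡ 2 * (1 + b)
  lemma₃ = solve-∀

  by-ones : ∀ x → a ≡ x → x ≤ 2 → ⊥
  -- The slack allows at most two 1s; as the cost is odd, zero or two are impossible.
  by-ones 0 a≡0 _ = even≢odd b (2 * k) (trans (cong (_+ 2 * b) (sym a≡0)) (trans (sym eq) (lemma₁ k)))
  by-ones 1 a≡1 _ with *-cancelˡ-≡ (2 * k) b 2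
    (suc-injective (trans (sym (lemma₁ k)) (trans eq (cong (_+ 2 * b) a≡1))))
  -- Now b = 2k is even and n = 3b + 1, the size at which a single 1 forces b to be odd.
  ... | 2k≡b with total-one⇒odd b₀ b₁ b₂ b₃ a₀ a₁ a₂ a₃ a≡1
                    (trans (lemma₂ k) (cong (λ b → 3 * b + 1) 2k≡b)) h
  ... | m , odd = even≢odd k m (trans 2k≡b odd)
  by-ones 2 a≡2 _ = even≢odd (1 + b) (2 * k) (trans (sym (lemma₃ b))
    (trans (cong (_+ 2 * b) (sym a≡2)) (trans (sym eq) (lemma₁ k))))
  by-ones (suc (suc (suc _))) _ (s≤s (s≤s ()))

-- n = 6k + 3 and cost 4k + 2 would leave 2k + 1 twos and nothing else.
no-tight-3 : ∀ k b₀ b₁ b₂ b₃ a₀ a₁ a₂ a₃ → AllHear (3 + k * 6) b₀ b₁ b₂ b₃ a₀ a₁ a₂ a₃ →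
  4 * k + 2 ≢ total a₀ a₁ a₂ a₃ + 2 * total b₀ b₁ b₂ b₃
no-tight-3 k b₀ b₁ b₂ b₃ a₀ a₁ a₂ a₃ h eq =
  by-ones a₀ a₁ a₂ a₃ h eq (few-ones 0 (3 + k * 6) {4 * k + 2} (lemma₀ k)
    (subst (λ c → 4 * (3 + k * 6) + total a₀ a₁ a₂ a₃ ≤ 6 * c) (sym eq)
      (double-count b₀ b₁ b₂ b₃ a₀ a₁ a₂ a₃ h)))
  where
  b : ℕ
  b = total b₀ b₁ b₂ b₃

  lemma₀ : ∀ k → 4 * (3 + k * 6) + 0 ≡ 6 * (4 * k + 2)
  lemma₀ = solve-∀
  lemma₁ : ∀ k → 4 * k + 2 ≡ 2 * (1 + 2 * k)
  lemma₁ = solve-∀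
  lemma₂ : ∀ k → 3 + k * 6 ≡ 3 * (1 + 2 * k) + 0
  lemma₂ = solve-∀

  by-ones : ∀ a₀ a₁ a₂ a₃ → AllHear (3 + k * 6) b₀ b₁ b₂ b₃ a₀ a₁ a₂ a₃ →
    4 * k + 2 ≡ total a₀ a₁ a₂ a₃ + 2 * b → total a₀ a₁ a₂ a₃ ≤ 0 → ⊥
  -- Here b = 2k + 1, but without 1s opposite rows agree and b is even.
  by-ones 0 0 0 0 h eq _ with *-cancelˡ-≡ (1 + 2 * k) b 2 (trans (sym (lemma₁ k)) eq)
  ... | 1+2k≡b = even≢odd (b₀ + b₁) k (sym (trans 1+2k≡b
    (no-ones⇒even b₀ b₁ b₂ b₃ (trans (lemma₂ k) (cong (λ b → 3 * b + 0) 1+2k≡b)) h)))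

row-totals-bound : ∀ k ρ b₀ b₁ b₂ b₃ a₀ a₁ a₂ a₃ →
  AllHear (toℕ ρ + k * 6) b₀ b₁ b₂ b₃ a₀ a₁ a₂ a₃ →
  4 * k + correction ρ ≤ total a₀ a₁ a₂ a₃ + 2 * total b₀ b₁ b₂ b₃
row-totals-bound k ρ b₀ b₁ b₂ b₃ a₀ a₁ a₂ a₃ h =
  go ρ h (double-count b₀ b₁ b₂ b₃ a₀ a₁ a₂ a₃ h)
  where
  a c : ℕ
  a = total a₀ a₁ a₂ a₃
  c = a + 2 * total b₀ b₁ b₂ b₃

  shift : ∀ y → 4 * k + y < c → 4 * k + suc y ≤ c
  shift y = subst (_≤ c) (sym (+-suc (4 * k) y))

  lemma₀ : ∀ k → 6 * (4 * k + 0) ≡ 4 * (0 + k * 6)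
  lemma₀ = solve-∀
  lemma₁ : ∀ k → 6 * (4 * k + 0) + 4 ≡ 4 * (1 + k * 6)
  lemma₁ = solve-∀
  lemma₂ : ∀ k → 6 * (4 * k + 1) + 2 ≡ 4 * (2 + k * 6)
  lemma₂ = solve-∀
  lemma₃ : ∀ k → 6 * (4 * k + 1) + 6 ≡ 4 * (3 + k * 6)
  lemma₃ = solve-∀
  lemma₄ : ∀ k → 6 * (4 * k + 2) + 4 ≡ 4 * (4 + k * 6)
  lemma₄ = solve-∀
  lemma₅ : ∀ k → 6 * (4 * k + 3) + 2 ≡ 4 * (5 + k * 6)
  lemma₅ = solve-∀

  go : ∀ ρ → AllHear (toℕ ρ + k * 6) b₀ b₁ b₂ b₃ a₀ a₁ a₂ a₃ →
       4 * (toℕ ρ + k * 6) + a ≤ 6 * c → 4 * k + correction ρ ≤ c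
  go 0F _ d = *-cancelˡ-≤ 6 (≤-trans (≤-reflexive (lemma₀ k)) (m+n≤o⇒m≤o _ d))
  -- The double count only gives `4 * k + 1`; excluding equality gains the last unit. Residue 3 is
  -- treated in the same way.
  go 1F h d = shift 1 (≤∧≢⇒< (shift 0 (exceeds _ 3 {1 + k * 6} (lemma₁ k) d))
                             (no-tight-1 k b₀ b₁ b₂ b₃ a₀ a₁ a₂ a₃ h))
  go 2F _ d = shift 1 (exceeds _ 1 {2 + k * 6} (lemma₂ k) d)
  go 3F h d = shift 2 (≤∧≢⇒< (shift 1 (exceeds _ 5 {3 + k * 6} (lemma₃ k) d))
                             (no-tight-3 k b₀ b₁ b₂ b₃ a₀ a₁ a₂ a₃ h))
  go 4F _ d = shift 2 (exceeds _ 3 {4 + k * 6} (lemma₄ k) d)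
  go 5F _ d = shift 3 (exceeds _ 1 {5 + k * 6} (lemma₅ k) d)

-- Sums

-- Summands live on ℕ rather than on `Fin n`, so that a cyclic shift is plain addition to the index.
∑< : ℕ → (ℕ → ℕ) → ℕ
∑< n φ = sum (applyUpTo φ n)

∑<-cong : ∀ n {φ ψ : ℕ → ℕ} → (∀ x → φ x ≡ ψ x) → ∑< n φ ≡ ∑< n ψ
∑<-cong zero    eq = refl
∑<-cong (suc n) eq = cong₂ _+_ (eq 0) (∑<-cong n (eq ∘ suc))

∑<-distrib-+ : ∀ n (φ ψ : ℕ → ℕ) → ∑< n (λ x → φ x + ψ x) ≡ ∑< n φ + ∑< n ψ
∑<-distrib-+ zero    φ ψ = refl
∑<-distrib-+ (suc n) φ ψ =
  trans (cong (φ 0 + ψ 0 +_) (∑<-distrib-+ n (φ ∘ suc) (ψ ∘ suc)))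
        (lemma (φ 0) (ψ 0) (∑< n (φ ∘ suc)) (∑< n (ψ ∘ suc)))
  where
  lemma : ∀ a b c d → (a + b) + (c + d) ≡ (a + c) + (b + d)
  lemma = solve-∀

∑<-zero : ∀ n → ∑< n (λ _ → 0) ≡ 0
∑<-zero zero    = refl
∑<-zero (suc n) = ∑<-zero n

∑<-exchange : ∀ {A : Set} n (φ : A → ℕ → ℕ) (es : List A) →
  ∑< n (λ x → sum (map (λ e → φ e x) es)) ≡ sum (map (λ e → ∑< n (φ e)) es)
∑<-exchange n φ []       = ∑<-zero n
∑<-exchange n φ (e ∷ es) = trans (∑<-distrib-+ n (φ e) _) (cong (∑< n (φ e) +_) (∑<-exchange n φ es))

∑<-lower : ∀ n (φ : ℕ → ℕ) → (∀ x → 1 ≤ φ x) → n ≤ ∑< n φ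
∑<-lower zero    φ pos = z≤n
∑<-lower (suc n) φ pos = +-mono-≤ (pos 0) (∑<-lower n (φ ∘ suc) (pos ∘ suc))

∑<-last : ∀ n (φ : ℕ → ℕ) → ∑< (suc n) φ ≡ ∑< n φ + φ n
∑<-last zero    φ = +-identityʳ (φ 0)
∑<-last (suc n) φ = trans (cong (φ 0 +_) (∑<-last n (φ ∘ suc))) (sym (+-assoc (φ 0) _ _))

-- Shifting by one drops `φ 0` and appends `φ n`, which is the same value by periodicity.
∑<-shift : ∀ n (φ : ℕ → ℕ) → (∀ x → φ (x + n) ≡ φ x) → ∀ t → ∑< n (λ x → φ (t + x)) ≡ ∑< n φ
∑<-shift n φ periodic zero    = refl
∑<-shift n φ periodic (suc t) = trans (∑<-shift n (φ ∘ suc) (periodic ∘ suc) t)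
  (+-cancelˡ-≡ (φ 0) _ _ (begin
    φ 0 + ∑< n (φ ∘ suc)  ≡⟨ ∑<-last n φ ⟩
    ∑< n φ + φ n          ≡⟨ cong (∑< n φ +_) (periodic 0) ⟩
    ∑< n φ + φ 0          ≡⟨ +-comm (∑< n φ) (φ 0) ⟩
    φ 0 + ∑< n φ          ∎))
  where open ≡-Reasoning

sum-member : ∀ {A : Set} (φ : A → ℕ) {e es} → e ∈ es → φ e ≤ sum (map φ es)
sum-member φ (here refl) = m≤m+n _ _
sum-member φ (there e∈) = ≤-trans (sum-member φ e∈) (m≤n+m _ _)

sum-cartesianProduct : ∀ {A B : Set} (φ : A × B → ℕ) xs ys →
  sum (map φ (cartesianProduct xs ys)) ≡ sum (map (λ x → sum (map (λ y → φ (x , y)) ys)) xs)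
sum-cartesianProduct φ []       ys = refl
sum-cartesianProduct φ (x ∷ xs) ys = begin
  sum (map φ (map (x ,_) ys ++ cartesianProduct xs ys))
    ≡⟨ cong sum (map-++ φ (map (x ,_) ys) _) ⟩
  sum (map φ (map (x ,_) ys) ++ map φ (cartesianProduct xs ys))
    ≡⟨ sum-++ (map φ (map (x ,_) ys)) _ ⟩
  sum (map φ (map (x ,_) ys)) + sum (map φ (cartesianProduct xs ys))
    ≡⟨ cong₂ _+_ (cong sum (sym (map-∘ ys))) (sum-cartesianProduct φ xs ys) ⟩
  sum (map (λ y → φ (x , y)) ys) + sum (map (λ x → sum (map (λ y → φ (x , y)) ys)) xs) ∎
  where open ≡-Reasoning

sum-tabulate : ∀ n (φ : ℕ → ℕ) → sum (tabulate {n = n} (φ ∘ toℕ)) ≡ ∑< n φ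
sum-tabulate zero    φ = refl
sum-tabulate (suc n) φ = cong (φ 0 +_) (sum-tabulate n (φ ∘ suc))

sum-allFin : ∀ n (ψ : Fin n → ℕ) (φ : ℕ → ℕ) → (∀ j → ψ j ≡ φ (toℕ j)) →
  sum (map ψ (allFin n)) ≡ ∑< n φ
sum-allFin n ψ φ eq = begin
  sum (map ψ (allFin n))         ≡⟨ cong sum (map-cong eq (allFin n)) ⟩
  sum (map (φ ∘ toℕ) (allFin n))   ≡⟨ cong sum (map-tabulate {n = n} (λ j → j) (φ ∘ toℕ)) ⟩
  sum (tabulate {n = n} (φ ∘ toℕ)) ≡⟨ sum-tabulate n φ ⟩
  ∑< n φ                         ∎
  where open ≡-Reasoning

-- `φ` may be any extension of the rows to ℕ: a periodic one for the lower bound, a sequence of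
-- columns for the upper bound.
cost-by-rows : ∀ n k (f : Broadcast (C 4 □ C n) k) (φ : Fin 4 → ℕ → ℕ) →
  (∀ r j → toℕ (f (r , j)) ≡ φ r (toℕ j)) →
  cost (C 4 □ C n) f ≡ sum (map (λ r → ∑< n (φ r)) (allFin 4))
cost-by-rows n k f φ eq = trans (sum-cartesianProduct (toℕ ∘ f) (allFin 4) (allFin n))
  (cong sum (map-cong (λ r → sum-allFin n _ (φ r) (eq r)) (allFin 4)))

-- Walks in cycles and products

module _ {n : ℕ} .{{_ : NonZero n}} where

  toℕ-mod : ∀ x → toℕ (x mod n) ≡ x % n
  toℕ-mod x = F.toℕ-fromℕ< (m%n<n x n)

  mod-cong : ∀ x y → x % n ≡ y % n → x mod n ≡ y mod n
  mod-cong x y eq = F.toℕ-injective (trans (toℕ-mod x) (trans eq (sym (toℕ-mod y))))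

  mod-periodic : ∀ x → (x + n) mod n ≡ x mod n
  mod-periodic x = mod-cong (x + n) x ([m+n]%n≡m%n x n)

  toℕ-mod-id : ∀ (j : Fin n) → toℕ j mod n ≡ j
  toℕ-mod-id j = F.toℕ-injective (trans (toℕ-mod (toℕ j)) (m<n⇒m%n≡m (F.toℕ<n j)))

  %-suc : ∀ x → suc (x % n) % n ≡ suc x % n
  %-suc x = begin
    (1 + x % n) % n          ≡⟨ %-distribˡ-+ 1 (x % n) n ⟩
    (1 % n + x % n % n) % n  ≡⟨ cong (λ y → (1 % n + y) % n) (m%n%n≡m%n x n) ⟩
    (1 % n + x % n) % n      ≡⟨ %-distribˡ-+ 1 x n ⟨
    (1 + x) % n              ∎
    where open ≡-Reasoning

  %-suc-cong : ∀ x y → x % n ≡ y % n → suc x % n ≡ suc y % n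
  %-suc-cong x y eq = trans (sym (%-suc x)) (trans (cong (λ z → suc z % n) eq) (%-suc y))

  -- Modulo n, `pred n` further successors undo one successor by going once around the cycle.
  %-suc-injective : ∀ x y → suc x % n ≡ suc y % n → x % n ≡ y % n
  %-suc-injective x y eq = begin
    x % n                 ≡⟨ wrap x ⟩
    (pred n + suc x) % n  ≡⟨ add (pred n) ⟩
    (pred n + suc y) % n  ≡⟨ wrap y ⟨
    y % n                 ∎
    where
    open ≡-Reasoning
    add : ∀ m → (m + suc x) % n ≡ (m + suc y) % n
    add zero    = eq
    add (suc m) = %-suc-cong (m + suc x) (m + suc y) (add m)
    wrap : ∀ x → x % n ≡ (pred n + suc x) % n
    wrap x = trans (sym ([m+n]%n≡m%n x n)) (cong (_% n) (begin
      x + n             ≡⟨ cong (x +_) (suc-pred n) ⟨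
      x + suc (pred n)  ≡⟨ +-suc x (pred n) ⟩
      suc (x + pred n)  ≡⟨ cong suc (+-comm x (pred n)) ⟩
      suc (pred n + x)  ≡⟨ +-suc (pred n) x ⟨
      pred n + suc x    ∎))

  successor-% : ∀ {i j : Fin n} → Successor i j → toℕ j ≡ suc (toℕ i) % n
  successor-% {j = j} (inj₁ eq) = trans (sym (m<n⇒m%n≡m (F.toℕ<n j))) (cong (_% n) (sym eq))
  successor-% (inj₂ (eq , j≡0)) = trans j≡0 (trans (sym (n%n≡0 n)) (cong (_% n) (sym eq)))

  -- Writing the vertex as `suc x` makes its predecessor `x`, without subtraction.
  neighbours : ∀ x {j} → Graph._~_ (C n) (suc x mod n) j → j ≡ x mod n ⊎ j ≡ suc (suc x) mod n
  neighbours x {j} (_ , inj₁ s) = inj₂ (F.toℕ-injective (begin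
    toℕ j                          ≡⟨ successor-% s ⟩
    suc (toℕ (suc x mod n)) % n    ≡⟨ cong (λ y → suc y % n) (toℕ-mod (suc x)) ⟩
    suc (suc x % n) % n            ≡⟨ %-suc (suc x) ⟩
    suc (suc x) % n                ≡⟨ toℕ-mod (suc (suc x)) ⟨
    toℕ (suc (suc x) mod n)        ∎))
    where open ≡-Reasoning
  neighbours x {j} (_ , inj₂ s) = inj₁ (trans (sym (toℕ-mod-id j))
    (mod-cong (toℕ j) x (%-suc-injective (toℕ j) x (trans (sym (successor-% s)) (toℕ-mod (suc x))))))

  successor-mod : ∀ x → Successor (x mod n) (suc x mod n)
  successor-mod x with m≤n⇒m<n∨m≡n (m%n<n x n)
  ... | inj₁ lt = inj₁ (begin
    suc (toℕ (x mod n))    ≡⟨ cong suc (toℕ-mod x) ⟩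
    suc (x % n)            ≡⟨ m<n⇒m%n≡m lt ⟨
    suc (x % n) % n        ≡⟨ %-suc x ⟩
    suc x % n              ≡⟨ toℕ-mod (suc x) ⟨
    toℕ (suc x mod n)      ∎)
    where open ≡-Reasoning
  ... | inj₂ eq = inj₂ (trans (cong suc (toℕ-mod x)) eq , (begin
    toℕ (suc x mod n)      ≡⟨ toℕ-mod (suc x) ⟩
    suc x % n              ≡⟨ %-suc x ⟨
    suc (x % n) % n        ≡⟨ cong (_% n) eq ⟩
    n % n                  ≡⟨ n%n≡0 n ⟩
    0                      ∎))
    where open ≡-Reasoning

successor-irrefl : ∀ {n} → 2 ≤ n → (i : Fin n) → ¬ Successor i i
successor-irrefl 2≤n i (inj₁ eq)          = 1+n≢n eq
successor-irrefl 2≤n i (inj₂ (eq , i≡0)) =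
  <⇒≢ 2≤n (trans (cong suc (sym i≡0)) eq)

edge : ∀ {n} .{{_ : NonZero n}} → 2 ≤ n → ∀ x → Graph._~_ (C n) (x mod n) (suc x mod n)
edge 2≤n x =
  (λ eq → successor-irrefl 2≤n _ (subst (Successor _) (sym eq) (successor-mod x))) ,
  inj₁ (successor-mod x)

_~?_ : ∀ {n} (i j : Fin n) → Dec (Graph._~_ (C n) i j)
_~?_ {n} i j = ¬? (i F.≟ j) ×-dec (successor? i j ⊎-dec successor? j i)
  where
  successor? : (i j : Fin n) → Dec (Successor i j)
  successor? i j = (suc (toℕ i) ≟ toℕ j) ⊎-dec ((suc (toℕ i) ≟ n) ×-dec (toℕ j ≟ 0))

□-adjacent? : ∀ {m n} (u v : Fin m × Fin n) → Dec (Graph._~_ (C m □ C n) u v)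
□-adjacent? (i , j) (i′ , j′) = ((i F.≟ i′) ×-dec (j ~? j′)) ⊎-dec ((i ~? i′) ×-dec (j F.≟ j′))

module _ (G : Graph) where
  open Graph G

  _++ʷ_ : ∀ {u v w k ℓ} → Walk G u v k → Walk G v w ℓ → Walk G u w (k + ℓ)
  []      ++ʷ q = q
  (e ∷ p) ++ʷ q = e ∷ (p ++ʷ q)

  -- `HearsFrom` asks for an exact distance, while the construction supplies a walk. Up to length 2,
  -- deciding equality and adjacency is enough: if both fail, every walk has at least 2 edges and
  -- the given one is shortest.
  distance≤2 : (∀ u v → Dec (u ≡ v)) → (∀ u v → Dec (u ~ v)) →
    ∀ {u v ℓ} → ℓ ≤ 2 → Walk G u v ℓ → ∃[ d ] (IsDistance G u v d × d ≤ ℓ)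
  distance≤2 _≟ᵛ_ _~ᵛ?_ {u} {v} {ℓ} ℓ≤2 p with u ≟ᵛ v
  ... | yes refl = 0 , ([] , λ _ _ → z≤n) , z≤n
  ... | no u≢v with u ~ᵛ? v
  ...   | yes e = 1 , (e ∷ [] , λ _ → positive) , positive p
    where
    positive : ∀ {ℓ} → Walk G u v ℓ → 1 ≤ ℓ
    positive []      = contradiction refl u≢v
    positive (_ ∷ _) = z<s
  ...   | no u≁v = ℓ , (p , λ _ q → ≤-trans ℓ≤2 (long q)) , ≤-refl
    where
    long : ∀ {ℓ} → Walk G u v ℓ → 2 ≤ ℓ
    long []          = contradiction refl u≢v
    long (e ∷ [])    = contradiction e u≁v
    long (_ ∷ (_ ∷ _)) = s<s z<s

module _ (G H : Graph) where
  private
    module G = Graph G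
    module H = Graph H

  walkˡ : ∀ {u v k} w → Walk G u v k → Walk (G □ H) (u , w) (v , w) k
  walkˡ w []      = []
  walkˡ w (e ∷ p) = inj₂ (e , refl) ∷ walkˡ w p

  walkʳ : ∀ {u v k} w → Walk H u v k → Walk (G □ H) (w , u) (w , v) k
  walkʳ w []      = []
  walkʳ w (e ∷ p) = inj₁ (refl , e) ∷ walkʳ w p

-- Lower bound

formula : ℕ → ℕ
formula n = 4 * (n / 6) + correction (n mod 6)

one two : Fin 3 → ℕ
one 1F = 1
one _  = 0
two 2F = 1
two _  = 0

value-split : ∀ v → toℕ v ≡ one v + (two v + two v)
value-split 0F = refl
value-split 1F = refl
value-split 2F = refl

above below : Fin 4 → Fin 4
above r = suc (toℕ r) mod 4
below r = (toℕ r + 3) mod 4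

row-neighbours : ∀ r r′ → Graph._~_ (C 4) r r′ → r′ ≡ above r ⊎ r′ ≡ below r
row-neighbours = from-yes (F.all? λ r → F.all? λ r′ →
  (r ~? r′) →-dec ((r′ F.≟ above r) ⊎-dec (r′ F.≟ below r)))

-- A row and a column offset; the centre of a ball has offset 2, so that no
-- offset in the ball is negative.
Position : Set
Position = Fin 4 × ℕ

adjacent : Position → List Position
adjacent (r , t) = (r , pred t) ∷ (r , suc t) ∷ (above r , t) ∷ (below r , t) ∷ []

-- Both vertical routes to the opposite row end in the same vertex, which is listed once. For small
-- n distinct offsets may name one vertex; counting it repeatedly only weakens the resulting
-- inequality.
ball₁ ball₂ : Fin 4 → List Position
ball₁ r = (r , 2) ∷ adjacent (r , 2)
ball₂ r = (r , 0) ∷ (r , 1) ∷ (r , 2) ∷ (r , 3) ∷ (r , 4)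
        ∷ (above r , 1) ∷ (above r , 2) ∷ (above r , 3)
        ∷ (below r , 1) ∷ (below r , 2) ∷ (below r , 3)
        ∷ (above (above r) , 2) ∷ []

-- A finite check over the four rows. The neighbours of the centre have offsets 1 to 3, so the
-- `pred` in `adjacent` never truncates.
two-steps : ∀ r → All (λ q → All (_∈ ball₂ r) (q ∷ adjacent q)) (adjacent (r , 2))
two-steps = from-yes (F.all? λ r →
  allᴸ? (λ q → allᴸ? (_∈? ball₂ r) (q ∷ adjacent q)) (adjacent (r , 2)))
  where open DecMembership (≡-dec F._≟_ _≟_)

module _ {n : ℕ} .{{_ : NonZero n}} where
  open Graph (C 4 □ C n) using (V; _~_)

  place : ℕ → Position → V
  place x (r , t) = r , (t + x) mod n

  Within : List Position → ℕ → V → Set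
  Within ps x v = ∃[ q ] (q ∈ ps × v ≡ place x q)

  step : ∀ x r t {v} → place x (r , suc t) ~ v → Within (adjacent (r , suc t)) x v
  step x r t (inj₁ (refl , e)) with neighbours (t + x) e
  ... | inj₁ refl = _ , here refl , refl
  ... | inj₂ refl = _ , there (here refl) , refl
  step x r t (inj₂ (e , refl)) with row-neighbours _ _ e
  ... | inj₁ refl = _ , there (there (here refl)) , refl
  ... | inj₂ refl = _ , there (there (there (here refl))) , refl

  walk-within₁ : ∀ x r {v ℓ} → Walk (C 4 □ C n) (place x (r , 2)) v ℓ → ℓ ≤ 1 → Within (ball₁ r) x v
  walk-within₁ x r [] _ = _ , here refl , refl
  walk-within₁ x r (e ∷ []) _ with step x r 1 e
  ... | q , q∈ , eq = q , there q∈ , eq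
  walk-within₁ x r (_ ∷ (_ ∷ _)) (s≤s ())

  walk-within₂ : ∀ x r {v ℓ} → Walk (C 4 □ C n) (place x (r , 2)) v ℓ → ℓ ≤ 2 → Within (ball₂ r) x v
  walk-within₂ x r [] _ = _ , there (there (here refl)) , refl
  walk-within₂ x r (_∷_ e p) (s≤s ℓ≤1) with step x r 1 e
  ... | q , q∈ , refl = further q q∈ p ℓ≤1
    where
    second-step : ∀ r′ t {v} → (r′ , suc t) ∈ adjacent (r , 2) → place x (r′ , suc t) ~ v →
                  Within (ball₂ r) x v
    second-step r′ t q∈ e with step x r′ t e
    ... | q′ , q′∈ , eq = q′ , lookup (lookup (two-steps r) q∈) (there q′∈) , eq

    further : ∀ q {v ℓ} → q ∈ adjacent (r , 2) → Walk (C 4 □ C n) (place x q) v ℓ → ℓ ≤ 1 →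
              Within (ball₂ r) x v
    further q q∈ [] _ = q , lookup (lookup (two-steps r) q∈) (here refl) , refl
    -- Each case exposes the offset of the first neighbour as a successor, the form that
    -- `second-step` takes.
    further _ q∈@(here refl) (e ∷ []) _ = second-step _ _ q∈ e
    further _ q∈@(there (here refl)) (e ∷ []) _ = second-step _ _ q∈ e
    further _ q∈@(there (there (here refl))) (e ∷ []) _ = second-step _ _ q∈ e
    further _ q∈@(there (there (there (here refl)))) (e ∷ []) _ = second-step _ _ q∈ e
    further q _ (_ ∷ (_ ∷ _)) (s≤s ())

  module _ (f : Broadcast (C 4 □ C n) 2) where

    -- Counts the broadcasting vertices around the listener `place x (r , 2)`: by symmetry of
    -- distance, the 2s it can hear lie in `ball₂` and the 1s in `ball₁`.
    hits : Fin 4 → ℕ → ℕ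
    hits r x = sum (map (λ q → two (f (place x q))) (ball₂ r))
             + sum (map (λ q → one (f (place x q))) (ball₁ r))

    hits-positive : Dominating (C 4 □ C n) f → ∀ r x → 1 ≤ hits r x
    hits-positive dominating r x with dominating (place x (r , 2))
    ... | v , positive , d , (walk , _) , d≤ with f v in eq
    ...   | 0F = contradiction positive λ ()
    ...   | 1F with walk-within₁ x r walk d≤
    ...     | q , q∈ , refl = ≤-trans (≤-trans (≤-reflexive (cong one (sym eq)))
              (sum-member (λ q → one (f (place x q))) q∈))
              (m≤n+m _ (sum (map (λ q → two (f (place x q))) (ball₂ r))))
    hits-positive dominating r x | v , positive , d , (walk , _) , d≤ | 2F
      with walk-within₂ x r walk d≤
    ...     | q , q∈ , refl = ≤-trans (≤-trans (≤-reflexive (cong two (sym eq)))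
              (sum-member (λ q → two (f (place x q))) q∈)) (m≤m+n _ _)

    row-sum : (Fin 3 → ℕ) → Fin 4 → ℕ
    row-sum φ r = ∑< n (λ x → φ (f (r , x mod n)))

    -- Turns local counts into row totals: after exchanging the sums, each position runs through a
    -- whole row as `x` varies, and its offset is a mere cyclic shift.
    ∑<-ball : ∀ φ (ps : List Position) →
      ∑< n (λ x → sum (map (λ q → φ (f (place x q))) ps)) ≡ sum (map (λ q → row-sum φ (proj₁ q)) ps)
    ∑<-ball φ ps = trans (∑<-exchange n (λ q x → φ (f (place x q))) ps)
      (cong sum (map-cong (λ (r , t) → ∑<-shift n (λ x → φ (f (r , x mod n)))
        (λ x → cong (λ j → φ (f (r , j))) (mod-periodic x)) t) ps))

    row-hits : Dominating (C 4 □ C n) f → ∀ r →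
      n ≤ sum (map (λ q → row-sum two (proj₁ q)) (ball₂ r))
        + sum (map (λ q → row-sum one (proj₁ q)) (ball₁ r))
    row-hits dominating r = begin
      n              ≤⟨ ∑<-lower n (hits r) (hits-positive dominating r) ⟩
      ∑< n (hits r)  ≡⟨ ∑<-distrib-+ n _ _ ⟩
      _              ≡⟨ cong₂ _+_ (∑<-ball two (ball₂ r)) (∑<-ball one (ball₁ r)) ⟩
      _              ∎
      where open ≤-Reasoning

    private
      b a : Fin 4 → ℕ
      b = row-sum two
      a = row-sum one

    all-hear : Dominating (C 4 □ C n) f →
      AllHear n (b 0F) (b 1F) (b 2F) (b 3F) (a 0F) (a 1F) (a 2F) (a 3F)
    all-hear dominating = hears
      (subst (n ≤_) (lemma (b 0F) (b 1F) (b 2F) (b 3F) (a 0F) (a 1F) (a 3F)) (row-hits dominating 0F))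
      (subst (n ≤_) (lemma (b 1F) (b 2F) (b 3F) (b 0F) (a 1F) (a 2F) (a 0F)) (row-hits dominating 1F))
      (subst (n ≤_) (lemma (b 2F) (b 3F) (b 0F) (b 1F) (a 2F) (a 3F) (a 1F)) (row-hits dominating 2F))
      (subst (n ≤_) (lemma (b 3F) (b 0F) (b 1F) (b 2F) (a 3F) (a 0F) (a 2F)) (row-hits dominating 3F))
      where
      lemma : ∀ b₀ b₁ b₂ b₃ a₀ a₁ a₃ →
        (b₀ + (b₀ + (b₀ + (b₀ + (b₀ + (b₁ + (b₁ + (b₁ + (b₃ + (b₃ + (b₃ + (b₂ + 0))))))))))))
          + (a₀ + (a₀ + (a₀ + (a₁ + (a₃ + 0)))))
        ≡ (5 * b₀ + (3 * b₁ + (b₂ + 3 * b₃))) + (3 * a₀ + (a₁ + a₃))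
      lemma = solve-∀

    row-cost : ∀ r → ∑< n (λ x → toℕ (f (r , x mod n))) ≡ a r + (b r + b r)
    row-cost r = trans (∑<-cong n (λ x → value-split (f (r , x mod n))))
      (trans (∑<-distrib-+ n _ _) (cong (a r +_) (∑<-distrib-+ n _ _)))

    cost-total : cost (C 4 □ C n) f ≡
      total (a 0F) (a 1F) (a 2F) (a 3F) + 2 * total (b 0F) (b 1F) (b 2F) (b 3F)
    cost-total = trans
      (cost-by-rows n 2 f (λ r x → toℕ (f (r , x mod n)))
        (λ r j → cong (λ j → toℕ (f (r , j))) (sym (toℕ-mod-id j))))
      (trans (cong sum (map-cong row-cost (allFin 4)))
        (lemma (b 0F) (b 1F) (b 2F) (b 3F) (a 0F) (a 1F) (a 2F) (a 3F)))
      where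
      lemma : ∀ b₀ b₁ b₂ b₃ a₀ a₁ a₂ a₃ →
        (a₀ + (b₀ + b₀)) + ((a₁ + (b₁ + b₁)) + ((a₂ + (b₂ + b₂)) + ((a₃ + (b₃ + b₃)) + 0)))
        ≡ (a₀ + (a₁ + (a₂ + a₃))) + 2 * (b₀ + (b₁ + (b₂ + b₃)))
      lemma = solve-∀

    lower-bound : Dominating (C 4 □ C n) f → formula n ≤ cost (C 4 □ C n) f
    lower-bound dominating = subst (formula n ≤_) (sym cost-total)
      (row-totals-bound (n / 6) (n mod 6) (b 0F) (b 1F) (b 2F) (b 3F) (a 0F) (a 1F) (a 2F) (a 3F)
        (subst (λ m → AllHear m (b 0F) (b 1F) (b 2F) (b 3F) (a 0F) (a 1F) (a 2F) (a 3F))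
          (trans (m≡m%n+[m/n]*n n 6) (cong (_+ n / 6 * 6) (sym (toℕ-mod n)))) (all-hear dominating)))

-- Upper bound

-- Distinct non-adjacent rows are opposite, and either row between them is a common neighbour;
-- `above r` is one choice.
row-across : ∀ r r′ → r ≢ r′ → ¬ Graph._~_ (C 4) r r′ →
  Graph._~_ (C 4) r (above r) × Graph._~_ (C 4) (above r) r′
row-across = from-yes (F.all? λ r → F.all? λ r′ →
  ¬? (r F.≟ r′) →-dec (¬? (r ~? r′) →-dec ((r ~? above r) ×-dec (above r ~? r′))))

row-walk : ∀ r r′ → ∃[ d ] Walk (C 4) r r′ d
row-walk r r′ with r F.≟ r′ | r ~? r′
... | yes refl | _      = 0 , []
... | no _     | yes e  = 1 , e ∷ []
... | no r≢r′  | no r≁r′ = let e , e′ = row-across r r′ r≢r′ r≁r′ in 2 , e ∷ (e′ ∷ [])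

column-walk : ∀ {n} .{{_ : NonZero n}} → 2 ≤ n → ∀ y (t : Fin 5) →
  Walk (C n) ((2 + y) mod n) ((toℕ t + y) mod n) ∣ 2 - toℕ t ∣
column-walk {n} 2≤n y = λ where
    0F → ~-sym (edge 2≤n (1 + y)) ∷ (~-sym (edge 2≤n y) ∷ [])
    1F → ~-sym (edge 2≤n (1 + y)) ∷ []
    2F → []
    3F → edge 2≤n (2 + y) ∷ []
    4F → edge 2≤n (2 + y) ∷ (edge 2≤n (3 + y) ∷ [])
  where open Graph (C n) using (~-sym)

-- Broadcasts as sequences of columns

Column : Set
Column = Fin 4 → Fin 3

infixr 4 _++ˢ_

-- The tail is an arbitrary infinite sequence, so a check that inspects only leading columns
-- evaluates even when the tail is a variable.
_++ˢ_ : List Column → (ℕ → Column) → ℕ → Column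
([]      ++ˢ s) x       = s x
((c ∷ w) ++ˢ s) zero    = c
((c ∷ w) ++ˢ s) (suc x) = (w ++ˢ s) x

-- For a broadcast given by its sequence of columns: column y + 2 is dominated.
CentreHears : (ℕ → Column) → ℕ → Set
CentreHears s y = ∀ r → ∃[ t ] ∃[ r′ ] (0 < toℕ (s (y + toℕ {5} t) r′)
  × proj₁ (row-walk r r′) + ∣ 2 - toℕ t ∣ ≤ toℕ (s (y + toℕ t) r′))

centreHears? : ∀ s y → Dec (CentreHears s y)
centreHears? s y = F.all? λ r → F.any? λ t → F.any? λ r′ →
  (0 <? toℕ (s (y + toℕ t) r′)) ×-dec
  (proj₁ (row-walk r r′) + ∣ 2 - toℕ t ∣ ≤? toℕ (s (y + toℕ t) r′))

module _ {n : ℕ} .{{_ : NonZero n}} (4≤n : 4 ≤ n) (s : ℕ → Column)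
         (wraps : ∀ (i : Fin 4) → s (n + toℕ i) ≡ s (toℕ i))
         (centre : ∀ y → y < n → CentreHears s y) where

  restrict : Broadcast (C 4 □ C n) 2
  restrict (r , j) = s (toℕ j) r

  -- A window of five columns starting before n ends at column n + 3 at the latest, so the four
  -- equations of `wraps` suffice; `4 ≤ n` keeps the wrapped index below n.
  periodic : ∀ y (t : Fin 5) → y < n → s ((toℕ t + y) % n) ≡ s (y + toℕ t)
  periodic y t y<n with toℕ t + y <? n
  ... | yes lt = cong s (trans (m<n⇒m%n≡m lt) (+-comm (toℕ t) y))
  ... | no ≮n = begin
      s ((toℕ t + y) % n)    ≡⟨ cong (λ x → s (x % n)) (sym eq) ⟩
      s ((n + toℕ i) % n)    ≡⟨ cong (λ x → s (x % n)) (+-comm n (toℕ i)) ⟩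
      s ((toℕ i + n) % n)    ≡⟨ cong s ([m+n]%n≡m%n (toℕ i) n) ⟩
      s (toℕ i % n)          ≡⟨ cong s (m<n⇒m%n≡m (<-≤-trans (F.toℕ<n i) 4≤n)) ⟩
      s (toℕ i)              ≡⟨ wraps i ⟨
      s (n + toℕ i)          ≡⟨ cong s (trans eq (+-comm (toℕ t) y)) ⟩
      s (y + toℕ t)          ∎
    where
    open ≡-Reasoning
    excess<4 : toℕ t + y ∸ n < 4
    excess<4 = +-cancelˡ-< n _ _ (subst (_< n + 4) (sym (m+[n∸m]≡n (≮⇒≥ ≮n)))
      (≤-<-trans (+-monoˡ-≤ y (F.toℕ≤pred[n] t)) (subst (4 + y <_) (+-comm 4 n) (+-monoʳ-< 4 y<n))))
    i : Fin 4
    i = fromℕ< excess<4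
    eq : n + toℕ i ≡ toℕ t + y
    eq = trans (cong (n +_) (F.toℕ-fromℕ< excess<4)) (m+[n∸m]≡n (≮⇒≥ ≮n))

  restrict-dominating : Dominating (C 4 □ C n) restrict
  restrict-dominating (r , j) with centre y y<n r
    where
    -- The window starts two columns before `j`, cyclically, so that `j` is its centre.
    y = (toℕ j + (n ∸ 2)) % n
    y<n : y < n
    y<n = m%n<n (toℕ j + (n ∸ 2)) n
  ... | t , r′ , pos , near = v , subst (0 <_) (sym value) pos , d , dist ,
        subst (d ≤_) (sym value) (≤-trans d≤ near)
    where
    y = (toℕ j + (n ∸ 2)) % n
    v = r′ , (toℕ t + y) mod n
    2≤n : 2 ≤ n
    2≤n = ≤-trans (s≤s (s≤s z≤n)) 4≤n
    value : toℕ (restrict v) ≡ toℕ (s (y + toℕ t) r′)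
    value = cong (λ c → toℕ (c r′)) (trans (cong s (toℕ-mod (toℕ t + y)))
      (periodic y t (m%n<n (toℕ j + (n ∸ 2)) n)))
    centre≡j : (2 + y) mod n ≡ j
    centre≡j = trans (mod-cong (2 + y) (toℕ j) (begin
        (2 + y) % n                      ≡⟨ %-suc-cong (1 + y) (1 + z) (%-suc-cong y z (m%n%n≡m%n z n)) ⟩
        (2 + z) % n                      ≡⟨ cong (_% n) (lemma (toℕ j) (n ∸ 2)) ⟩
        (toℕ j + (2 + (n ∸ 2))) % n      ≡⟨ cong (λ m → (toℕ j + m) % n) (m+[n∸m]≡n 2≤n) ⟩
        (toℕ j + n) % n                  ≡⟨ [m+n]%n≡m%n (toℕ j) n ⟩
        toℕ j % n                        ∎)) (toℕ-mod-id j)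
      where
      open ≡-Reasoning
      z = toℕ j + (n ∸ 2)
      lemma : ∀ a b → 2 + (a + b) ≡ a + (2 + b)
      lemma = solve-∀
    walk : Walk (C 4 □ C n) (r , j) v (proj₁ (row-walk r r′) + ∣ 2 - toℕ t ∣)
    walk = _++ʷ_ (C 4 □ C n) (walkˡ (C 4) (C n) j (proj₂ (row-walk r r′)))
      (walkʳ (C 4) (C n) r′
        (subst (λ i → Walk (C n) i ((toℕ t + y) mod n) _) centre≡j (column-walk 2≤n y t)))
    shortest = distance≤2 (C 4 □ C n) (≡-dec F._≟_ F._≟_) □-adjacent?
      (≤-trans near (F.toℕ≤pred[n] (s (y + toℕ t) r′))) walk
    d = proj₁ shortest
    dist = proj₁ (proj₂ shortest)
    d≤ = proj₂ (proj₂ shortest)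

weight : Column → ℕ
weight c = sum (map (λ r → toℕ (c r)) (allFin 4))

restrict-cost : ∀ {n} (f : Broadcast (C 4 □ C n) 2) (s : ℕ → Column) →
  (∀ r j → f (r , j) ≡ s (toℕ j) r) → cost (C 4 □ C n) f ≡ ∑< n (weight ∘ s)
restrict-cost {n} f s eq = trans
  (cost-by-rows n 2 f (λ r x → toℕ (s x r)) (λ r j → cong toℕ (eq r j)))
  (sym (∑<-exchange n (λ r x → toℕ (s x r)) (allFin 4)))

-- The explicit broadcasts

blank : Column
blank _ = 0F

1at 2at : Fin 4 → Column
1at r r′ = if does (r F.≟ r′) then 1F else 0F
2at r r′ = if does (r F.≟ r′) then 2F else 0F

-- Separates an initial segment, settled by evaluation, from the rest, settled by induction.
extend : ∀ m {n} {P : ℕ → Set} → (∀ (i : Fin m) → P (toℕ i)) →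
  (∀ x → x < n → P (m + x)) → ∀ x → x < m + n → P x
extend zero    p q x       lt       = q x lt
extend (suc m) p q zero    lt       = p 0F
extend (suc m) p q (suc x) (s<s lt) = extend m (p ∘ suc) q x lt

block : List Column
block = 2at 0F ∷ blank ∷ blank ∷ 2at 2F ∷ blank ∷ blank ∷ []

-- The minimal broadcast for n = 6k + 4 + ρ consists, up to a rotation, of k
-- blocks followed by the columns 2at 0F, blank, middle ρ, end₀ ρ and end₁ ρ.
middle : Fin 6 → List Column
middle 0F = []
middle 1F = blank ∷ []
middle 2F = blank ∷ 2at 2F ∷ []
middle 3F = blank ∷ 2at 2F ∷ blank ∷ []
middle 4F = blank ∷ 2at 2F ∷ blank ∷ 1at 0F ∷ []
middle 5F = blank ∷ 2at 2F ∷ blank ∷ blank ∷ 2at 0F ∷ []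

end₀ end₁ : Fin 6 → Column
end₀ 0F = 1at 2F
end₀ 1F = 2at 2F
end₀ 2F = blank
end₀ 3F = blank
end₀ 4F = 1at 2F
end₀ 5F = 1at 2F
end₁ 3F = 2at 0F
end₁ _  = blank

module _ (ρ : Fin 6) where
  -- After the two end columns come `2at 0F` and `blank`: these four columns repeat the start of
  -- `broadcast`, as far as a window can reach past the end.
  ending : ℕ → Column
  ending = end₀ ρ ∷ end₁ ρ ∷ 2at 0F ∷ blank ∷ [] ++ˢ λ _ → blank

  blocks : ℕ → ℕ → Column
  blocks zero    = 2at 0F ∷ blank ∷ [] ++ˢ middle ρ ++ˢ ending
  blocks (suc k) = block ++ˢ blocks k

  -- The rotation puts the end columns first, so that the four columns recurring after the end are
  -- the same for every number of blocks.
  broadcast : ℕ → ℕ → Column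
  broadcast k = end₀ ρ ∷ end₁ ρ ∷ [] ++ˢ blocks k

  size : ℕ → ℕ
  size k = k * 6 + (4 + length (middle ρ))

-- Four finite checks cover all windows: those of a broadcast without blocks, and those starting in
-- the last block, in the end columns before a block, or in a block followed by another.
centre-zero : ∀ ρ (i : Fin (size ρ 0)) → CentreHears (broadcast ρ 0) (toℕ i)
centre-zero = from-yes (F.all? {6} λ ρ → F.all? {size ρ 0} λ i →
  centreHears? (broadcast ρ 0) (toℕ i))

centre-first : ∀ ρ (i : Fin 6) → CentreHears (blocks ρ 1) (toℕ i)
centre-first = from-yes (F.all? {6} λ ρ → F.all? {6} λ i → centreHears? (blocks ρ 1) (toℕ i))

centre-ends : ∀ s ρ (i : Fin 2) → CentreHears (end₀ ρ ∷ end₁ ρ ∷ [] ++ˢ block ++ˢ s) (toℕ i)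
centre-ends s = from-yes (F.all? {6} λ ρ → F.all? {2} λ i →
  centreHears? (end₀ ρ ∷ end₁ ρ ∷ [] ++ˢ block ++ˢ s) (toℕ i))

-- A window starting in the first block ends within the second, so the tail `s` is never inspected.
centre-inner : ∀ s (i : Fin 6) → CentreHears (block ++ˢ block ++ˢ s) (toℕ i)
centre-inner s = from-yes (F.all? {6} λ i → centreHears? (block ++ˢ block ++ˢ s) (toℕ i))

blocks-centre : ∀ (ρ : Fin 6) k x → x < k * 6 + (2 + length (middle ρ)) → CentreHears (blocks ρ k) x
-- `blocks ρ 0` is `broadcast ρ 0` without its two leading columns, so position x is position 2 + x
-- there.
blocks-centre ρ zero x x< = subst (CentreHears (broadcast ρ 0))
  (F.toℕ-fromℕ< (s<s (s<s x<))) (centre-zero ρ (fromℕ< (s<s (s<s x<))))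
blocks-centre ρ 1 = extend 6 (centre-first ρ) (blocks-centre ρ 0)
blocks-centre ρ (suc (suc k)) =
  extend 6 (centre-inner (blocks ρ k)) (blocks-centre ρ (suc k))

size-unfold : ∀ k z → k * 6 + (4 + z) ≡ 2 + (k * 6 + (2 + z))
size-unfold = solve-∀

broadcast-centre : ∀ (ρ : Fin 6) k y → y < size ρ k → CentreHears (broadcast ρ k) y
broadcast-centre ρ zero y y< = subst (CentreHears (broadcast ρ 0))
  (F.toℕ-fromℕ< y<) (centre-zero ρ (fromℕ< y<))
broadcast-centre ρ (suc k) y y< = extend 2 (centre-ends (blocks ρ k) ρ) (blocks-centre ρ (suc k)) y
  (subst (y <_) (size-unfold (suc k) (length (middle ρ))) y<)

++ˢ-drop : ∀ w s i → (w ++ˢ s) (length w + i) ≡ s i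
++ˢ-drop []      s i = refl
++ˢ-drop (_ ∷ w) s i = ++ˢ-drop w s i

blocks-drop : ∀ (ρ : Fin 6) k z → blocks ρ k (k * 6 + z) ≡ blocks ρ 0 z
blocks-drop ρ zero    z = refl
blocks-drop ρ (suc k) z = blocks-drop ρ k z

broadcast-wraps : ∀ (ρ : Fin 6) (k : ℕ) (i : Fin 4) →
  broadcast ρ k (size ρ k + toℕ i) ≡ broadcast ρ k (toℕ i)
broadcast-wraps ρ k i = begin
  broadcast ρ k (size ρ k + toℕ i)                  ≡⟨ cong (broadcast ρ k) (+-assoc (k * 6) (4 + l) (toℕ i)) ⟩
  broadcast ρ k (k * 6 + (4 + (l + toℕ i)))         ≡⟨ cong (broadcast ρ k) (size-unfold k (l + toℕ i)) ⟩
  blocks ρ k (k * 6 + (2 + (l + toℕ i)))           ≡⟨ blocks-drop ρ k (2 + (l + toℕ i)) ⟩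
  (middle ρ ++ˢ ending ρ) (l + toℕ i)              ≡⟨ ++ˢ-drop (middle ρ) (ending ρ) (toℕ i) ⟩
  ending ρ (toℕ i)                                 ≡⟨ start i k ⟩
  broadcast ρ k (toℕ i)                             ∎
  where
  open ≡-Reasoning
  l = length (middle ρ)
  start : ∀ i k → ending ρ (toℕ i) ≡ broadcast ρ k (toℕ i)
  start 0F _ = refl
  start 1F _ = refl
  -- The columns now depend on whether a block follows, but in both cases they are `2at 0F` and
  -- `blank`.
  start 2F zero    = refl
  start 2F (suc _) = refl
  start 3F zero    = refl
  start 3F (suc _) = refl

-- Cost of the explicit broadcasts

∑<-++ˢ : ∀ (φ : Column → ℕ) w s → ∑< (length w) (φ ∘ (w ++ˢ s)) ≡ sum (map φ w)
∑<-++ˢ φ []      s = refl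
∑<-++ˢ φ (c ∷ w) s = cong (φ c +_) (∑<-++ˢ φ w s)

blocks-weight : ∀ (ρ : Fin 6) k → ∑< (k * 6 + (2 + length (middle ρ))) (weight ∘ blocks ρ k)
  ≡ k * 4 + (2 + sum (map weight (middle ρ)))
blocks-weight ρ zero    = cong (2 +_) (∑<-++ˢ weight (middle ρ) (ending ρ))
blocks-weight ρ (suc k) = cong (4 +_) (blocks-weight ρ k)

formula-suc : ∀ n → formula (6 + n) ≡ 4 + formula n
formula-suc n = begin
  4 * ((6 + n) / 6) + c  ≡⟨ cong (λ q → 4 * q + c) (m/n≡1+[m∸n]/n {6 + n} {6} (m≤m+n 6 n)) ⟩
  4 * suc (n / 6) + c    ≡⟨ cong (_+ c) (*-suc 4 (n / 6)) ⟩
  4 + 4 * (n / 6) + c    ≡⟨ +-assoc 4 (4 * (n / 6)) c ⟩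
  4 + formula n          ∎
  where
  open ≡-Reasoning
  c = correction (n mod 6)

formula-blocks : ∀ k z → formula (k * 6 + z) ≡ k * 4 + formula z
formula-blocks zero    z = refl
formula-blocks (suc k) z = trans (formula-suc (k * 6 + z)) (cong (4 +_) (formula-blocks k z))

-- A block adds six columns and cost 4, just as the formula grows by 4 when n grows by 6. Only the
-- sizes 4 to 9, without blocks, remain to be evaluated.
broadcast-weight : ∀ (ρ : Fin 6) k → ∑< (size ρ k) (weight ∘ broadcast ρ k) ≡ formula (size ρ k)
broadcast-weight ρ k = begin
  ∑< (size ρ k) (weight ∘ broadcast ρ k)
    ≡⟨ cong (λ n → ∑< n (weight ∘ broadcast ρ k)) (size-unfold k (length (middle ρ))) ⟩
  weight (end₀ ρ) + (weight (end₁ ρ) + ∑< (k * 6 + (2 + length (middle ρ))) (weight ∘ blocks ρ k))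
    ≡⟨ cong (λ x → weight (end₀ ρ) + (weight (end₁ ρ) + x)) (blocks-weight ρ k) ⟩
  weight (end₀ ρ) + (weight (end₁ ρ) + (k * 4 + (2 + sum (map weight (middle ρ)))))
    ≡⟨ lemma (weight (end₀ ρ)) (weight (end₁ ρ)) k (2 + sum (map weight (middle ρ))) ⟩
  k * 4 + (weight (end₀ ρ) + (weight (end₁ ρ) + (2 + sum (map weight (middle ρ)))))
    ≡⟨ cong (k * 4 +_) (check ρ) ⟩
  k * 4 + formula (size ρ 0)
    ≡⟨ formula-blocks k (size ρ 0) ⟨
  formula (size ρ k) ∎
  where
  open ≡-Reasoning
  lemma : ∀ a b k c → a + (b + (k * 4 + c)) ≡ k * 4 + (a + (b + c))
  lemma = solve-∀
  check : ∀ ρ → weight (end₀ ρ) + (weight (end₁ ρ) + (2 + sum (map weight (middle ρ))))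
        ≡ formula (size ρ 0)
  check 0F = refl
  check 1F = refl
  check 2F = refl
  check 3F = refl
  check 4F = refl
  check 5F = refl

-- Remainders run from 4 to 9 instead of 0 to 5, so that each has an explicit broadcast even without
-- blocks.
decompose : ∀ {n} → 4 ≤ n → ∃[ k ] ∃[ ρ ] n ≡ size ρ k
decompose {n} 4≤n with (n ∸ 4) divMod 6
... | result q ρ eq = q , ρ , (begin
    n                     ≡⟨ m+[n∸m]≡n 4≤n ⟨
    4 + (n ∸ 4)           ≡⟨ cong (4 +_) eq ⟩
    4 + (toℕ ρ + q * 6)   ≡⟨ lemma (toℕ ρ) q ⟩
    q * 6 + (4 + toℕ ρ)   ≡⟨ cong (λ l → q * 6 + (4 + l)) (middle-length ρ) ⟩
    size ρ q              ∎)
  where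
  open ≡-Reasoning
  lemma : ∀ r q → 4 + (r + q * 6) ≡ q * 6 + (4 + r)
  lemma = solve-∀
  middle-length : ∀ ρ → toℕ ρ ≡ length (middle ρ)
  middle-length = from-yes (F.all? {6} λ ρ → toℕ ρ ≟ length (middle ρ))

upper-bound : ∀ {n} .{{_ : NonZero n}} → 4 ≤ n →
  ∃[ f ] (Dominating (C 4 □ C n) {2} f × cost (C 4 □ C n) f ≡ formula n)
upper-bound 4≤n with decompose 4≤n
... | k , ρ , refl = f ,
    restrict-dominating 4≤n (broadcast ρ k) (broadcast-wraps ρ k) (broadcast-centre ρ k) ,
    trans (restrict-cost f (broadcast ρ k) λ _ _ → refl) (broadcast-weight ρ k)
  where
  f = restrict 4≤n (broadcast ρ k) (broadcast-wraps ρ k) (broadcast-centre ρ k)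

theorem4p3 : (n : ℕ) → n ≥ 4 → γ-b[ 2 , C 4 □ C n ]≡ (4 * (n / 6) + correction (n mod 6))
theorem4p3 n@(suc _) 4≤n = upper-bound 4≤n , lower-bound
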